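{- Let $n, k, \ell$ be positive integers with $n \geq k\ell$, $\ell \geq 2$, and $k \geq 3$. If $\mathcal{P}$ is an intersecting family of $(k,\ell)$-subpartitions of $[n]$, then $$|\mathcal{P}| \leq \frac{1}{(\ell-1)!} \prod_{i=1}^{\ell-1}\binom{n-ik}{k}.$$ Moreover, this bound is attained only by a canonical intersecting family of $(k,\ell)$-subpartitions, i.e. a family consisting of all $(k,\ell)$-subpartitions of $[n]$ that contain a fixed $k$-subset of $[n]$ as one of their classes.
   Context: Let $[n]=\{1,\dots,n\}$. A $(k,\ell)$-subpartition of $[n]$ is a set $P=\{P_1,\dots,P_\ell\}$ of $\ell$ pairwise disjoint $k$-subsets of $[n]$ (called classes); thus $|\bigcup_i P_i| = k\ell$. Two $(k,\ell)$-subpartitions $P=\{P_1,\dots,P_\ell\}$ and $Q=\{Q_1,\dots,Q_\ell\}$ are intersecting if $P_i=Q_j$ for some $i,j$, i.e. they have a common class. A family is intersecting if every two of its members are intersecting. -}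

module Defs where

open import Data.Nat using (ℕ; zero; suc; _*_; _∸_; _!)
open import Data.Nat.Combinatorics using (_C_)
open import Data.Fin.Subset using (Subset; ∣_∣; _∩_; Empty)
open import Data.List using (List; length)
open import Data.List.Membership.Propositional using (_∈_)
open import Data.List.Relation.Unary.All using (All)
open import Data.List.Relation.Unary.AllPairs using (AllPairs)
open import Data.Product using (_×_; ∃)
open import Relation.Binary.PropositionalEquality using (_≡_)
open import Relation.Nullary using (¬_)

Disjoint : ∀ {n} → Subset n → Subset n → Set
Disjoint p q = Empty (p ∩ q)

-- A (k,ℓ)-subpartition of [n]: ℓ pairwise disjoint k-subsets of [n].
-- Represented by a list of its classes; two such lists represent the same
-- subpartition iff they have the same classes (see SameClasses).
record SubPartition (n k ℓ : ℕ) : Set where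
  field
    classes : List (Subset n)
    len     : length classes ≡ ℓ
    sizes   : All (λ c → ∣ c ∣ ≡ k) classes
    disj    : AllPairs Disjoint classes
open SubPartition public

SameClasses : ∀ {n k ℓ} → SubPartition n k ℓ → SubPartition n k ℓ → Set
SameClasses P Q = (∀ c → c ∈ classes P → c ∈ classes Q)
                × (∀ c → c ∈ classes Q → c ∈ classes P)

Intersecting : ∀ {n k ℓ} → SubPartition n k ℓ → SubPartition n k ℓ → Set
Intersecting P Q = ∃ λ c → c ∈ classes P × c ∈ classes Q

-- A family of subpartitions: a list with no two members equal (as subpartitions);
-- its cardinality is the length of the list.
Distinct : ∀ {n k ℓ} → List (SubPartition n k ℓ) → Set
Distinct F = AllPairs (λ P Q → ¬ SameClasses P Q) F

IntersectingFamily : ∀ {n k ℓ} → List (SubPartition n k ℓ) → Set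
IntersectingFamily F = ∀ P Q → P ∈ F → Q ∈ F → Intersecting P Q

prodBinom : ℕ → ℕ → ℕ → ℕ
prodBinom n k zero    = 1
prodBinom n k (suc m) = prodBinom n k m * ((n ∸ suc m * k) C k)

{-# OPTIONS --safe #-}

-- Double counting the pairs (P , A), where A is a further class of a member P,
-- shows by induction on m that at most (1/m!) ∏_{j ≤ i < ℓ} C(n - ik, k)
-- subpartitions contain j = ℓ - m prescribed classes.  For j = 1 this is the
-- bound for families with a common class; such a family attaining it cannot be
-- enlarged, hence is canonical.
--
-- Suppose that no class is common to all members.  Every member contains one of
-- the ℓ classes A of a fixed member; some member Q avoids A, so every member
-- through A also contains one of the ℓ classes of Q.  The family therefore has at
-- most ℓ² times as many members as there are subpartitions through two given
-- classes, which is below the bound because (ℓ - 1)ℓ² < C(n - k, k).  This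
-- inequality may fail for ℓ = 2 and small n, but in that case the family yields
-- three pairwise disjoint classes, so n ≥ 3k.

module Submission where

open import Defs
open import Data.Bool using (T; true; false)
import Data.Bool.Properties as Bool
open import Data.Fin.Subset using (Subset; Nonempty; ∣_∣; _∪_; ∁; ⋃; ⊥; inside; outside)
  renaming (_∈_ to _∈ₛ_; _⊆_ to _⊆ₛ_)
open import Data.Fin.Subset.Properties
  using (x∈p∩q⁺; x∈p∩q⁻; x∈p∪q⁺; x∈p∪q⁻; x∉p⇒x∈∁p; x∈∁p⇒x∉p; x∈p⇒∣p-x∣<∣p∣; ⊥⊆; ∉⊥; out⊆; s⊆s; drop-∷-⊆;
         ∣⊥∣≡0; ∣∁p∣≡n∸∣p∣; ∣p∣≤n; nonempty?; Empty-unique; drop-∷-Empty; anySubset?)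
open import Data.List using (List; []; _∷_; [_]; _++_; length; filter; map)
open import Data.List.Membership.Propositional using (_∈_; _∉_; find; lose)
import Data.List.Membership.DecPropositional as DecMembership
open import Data.List.Membership.Propositional.Properties
  using (∈-++⁺ˡ; ∈-++⁺ʳ; ∈-++⁻; ∈-∃++; ∈-map⁺; ∈-map⁻; ∈-filter⁺)
open import Data.List.Properties using (length-map; length-++; length-++-sucʳ; filter-some)
import Data.List.Relation.Binary.Subset.DecPropositional as DecSubset
open import Data.List.Relation.Binary.Subset.Propositional using (_⊆_)
open import Data.List.Relation.Unary.All as All using (All; []; _∷_)
import Data.List.Relation.Unary.All.Properties as All
open import Data.List.Relation.Unary.AllPairs using (AllPairs; []; _∷_)
import Data.List.Relation.Unary.AllPairs.Properties as AllPairs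
open import Data.List.Relation.Unary.Any as Any using (Any; here; there)
open import Data.List.Relation.Unary.Unique.Propositional using (Unique)
open import Data.Nat
  using (ℕ; zero; suc; _+_; _*_; _∸_; _!; _≤_; _<_; _≤ᵇ_; _≤′_; ≤′-refl; ≤′-step; z≤n; s≤s; z<s; >-nonZero)
open import Data.Nat.Combinatorics using (_C_; nCn≡1; nCk≡nPk/k!; nCk+nC[k+1]≡[n+1]C[k+1])
import Data.Nat.Combinatorics as ℕ using (_P_)
open import Data.Nat.Combinatorics.Specification using (k!∣nP′k)
open import Data.Nat.DivMod using (m/n*n≡m)
open import Data.Nat.Divisibility using (_∣_; _∣0)
open import Data.Nat.ListAction using (sum)
open import Data.Nat.Properties
open import Algebra.Properties.CommutativeSemigroup +-commutativeSemigroup using (x∙yz≈y∙xz)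
open import Data.Nat.Tactic.RingSolver using (solve-∀)
open import Data.Product using (_×_; _,_; ∃)
open import Data.Sum using (_⊎_; inj₁; inj₂)
open import Data.Vec using ([]; _∷_; here)
import Data.Vec.Properties as Vec
open import Function.Bundles using (_⇔_; mk⇔)
open import Relation.Binary.Core using (Rel)
open import Relation.Binary.Definitions using (DecidableEquality; Symmetric)
open import Relation.Binary.PropositionalEquality
  using (_≡_; _≢_; refl; sym; trans; cong; cong₂; subst; module ≡-Reasoning)
open import Relation.Nullary using (Dec; yes; no; does; contradiction)
open import Relation.Nullary.Decidable using (map′; _×-dec_)

m+n≤o⇒n≤o∸m : ∀ m {n o} → m + n ≤ o → n ≤ o ∸ m
m+n≤o⇒n≤o∸m m {n} m+n≤o = m+n≤o⇒m≤o∸n n (≤-trans (≤-reflexive (+-comm n m)) m+n≤o)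

-- Binomial coefficients

nCk≤[1+n]Ck : ∀ n k → n C k ≤ suc n C k
nCk≤[1+n]Ck n zero    = ≤-refl
nCk≤[1+n]Ck n (suc k) = ≤-trans (m≤n+m _ _) (≤-reflexive (nCk+nC[k+1]≡[n+1]C[k+1] n k))

nCk≤[1+n]C[1+k] : ∀ n k → n C k ≤ suc n C suc k
nCk≤[1+n]C[1+k] n k = ≤-trans (m≤m+n _ _) (≤-reflexive (nCk+nC[k+1]≡[n+1]C[k+1] n k))

nCk≤[d+n]C[d+k] : ∀ d n k → n C k ≤ (d + n) C (d + k)
nCk≤[d+n]C[d+k] zero    n k = ≤-refl
nCk≤[d+n]C[d+k] (suc d) n k = ≤-trans (nCk≤[d+n]C[d+k] d n k) (nCk≤[1+n]C[1+k] (d + n) (d + k))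

C-monoˡ-≤ : ∀ k {m n} → m ≤ n → m C k ≤ n C k
C-monoˡ-≤ k m≤n = mono (≤⇒≤′ m≤n)
  where
  mono : ∀ {m n} → m ≤′ n → m C k ≤ n C k
  mono ≤′-refl           = ≤-refl
  mono (≤′-step {n} m≤n) = ≤-trans (mono m≤n) (nCk≤[1+n]Ck n k)

k≤n⇒0<nCk : ∀ {n k} → k ≤ n → 0 < n C k
k≤n⇒0<nCk {k = k} k≤n = ≤-trans (≤-reflexive (sym (nCn≡1 k))) (C-monoˡ-≤ k k≤n)

k!∣nPk : ∀ n k → k ! ∣ n ℕ.P k
k!∣nPk n k with k ≤ᵇ n in eq
... | true  = k!∣nP′k (≤ᵇ⇒≤ k n (subst T (sym eq) _))
... | false = (k !) ∣0

nCk*k!≡nPk : ∀ {n k} → k ≤ n → (n C k) * k ! ≡ n ℕ.P k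
nCk*k!≡nPk {n} {k} k≤n = trans (cong (_* k !) (nCk≡nPk/k! k≤n)) (m/n*n≡m {{k !≢0}} (k!∣nPk n k))

m*[1+m]²<[3m]C3 : ∀ {m} → 2 ≤ m → m * (suc m * suc m) < (3 * m) C 3
m*[1+m]²<[3m]C3 {suc (suc q)} (s≤s (s≤s z≤n)) = *-cancelʳ-< (3 !) _ _ (begin-strict
  (2 + q) * ((3 + q) * (3 + q)) * 6
    <⟨ m<m+n _ z<s ⟩
  (2 + q) * ((3 + q) * (3 + q)) * 6 + (2 + q) * (3 * (2 + 15 * q + 7 * (q * q)))
    ≡⟨ expand q ⟩
  (4 + 3 * q) * ((5 + 3 * q) * ((6 + 3 * q) * 1))
    ≡⟨⟩
  (6 + 3 * q) ℕ.P 3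
    ≡⟨ nCk*k!≡nPk {6 + 3 * q} (m≤m+n 3 _) ⟨
  ((6 + 3 * q) C 3) * 3 !
    ≡⟨ cong (λ N → (N C 3) * 3 !) (*-distribˡ-+ 3 2 q) ⟨
  ((3 * (2 + q)) C 3) * 3 ! ∎)
  where
  open ≤-Reasoning
  expand : ∀ q → (2 + q) * ((3 + q) * (3 + q)) * 6 + (2 + q) * (3 * (2 + 15 * q + 7 * (q * q)))
               ≡ (4 + 3 * q) * ((5 + 3 * q) * ((6 + 3 * q) * 1))
  expand = solve-∀

m*[1+m]²<nCk : ∀ {m k n} → 2 ≤ m → 3 ≤ k → m * k ≤ n → m * (suc m * suc m) < n C k
m*[1+m]²<nCk {m} {k} {n} 2≤m 3≤k mk≤n = begin-strict
  m * (suc m * suc m)              <⟨ m*[1+m]²<[3m]C3 2≤m ⟩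
  (3 * m) C 3                      ≤⟨ nCk≤[d+n]C[d+k] (k ∸ 3) (3 * m) 3 ⟩
  (k ∸ 3 + 3 * m) C (k ∸ 3 + 3)    ≡⟨ cong ((k ∸ 3 + 3 * m) C_) k∸3+3≡k ⟩
  (k ∸ 3 + 3 * m) C k              ≤⟨ C-monoˡ-≤ k (≤-trans k∸3+3m≤mk mk≤n) ⟩
  n C k                            ∎
  where
  open ≤-Reasoning
  instance _ = >-nonZero (≤-trans z<s 2≤m)

  k∸3+3≡k : k ∸ 3 + 3 ≡ k
  k∸3+3≡k = m∸n+n≡m 3≤k

  k∸3+3m≤mk : k ∸ 3 + 3 * m ≤ m * k
  k∸3+3m≤mk = begin
    k ∸ 3 + 3 * m          ≤⟨ +-monoˡ-≤ (3 * m) (m≤m*n (k ∸ 3) m) ⟩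
    (k ∸ 3) * m + 3 * m    ≡⟨ *-distribʳ-+ m (k ∸ 3) 3 ⟨
    (k ∸ 3 + 3) * m        ≡⟨ cong (_* m) k∸3+3≡k ⟩
    k * m                  ≡⟨ *-comm k m ⟩
    m * k                  ∎

-- The number of sequences of m pairwise disjoint k-subsets of an N-set.
packings : ℕ → ℕ → ℕ → ℕ
packings N k zero    = 1
packings N k (suc m) = (N C k) * packings (N ∸ k) k m

packings-last : ∀ N k m → packings N k (suc m) ≡ packings N k m * ((N ∸ m * k) C k)
packings-last N k zero    = *-comm (N C k) 1
packings-last N k (suc m) = begin
  (N C k) * packings (N ∸ k) k (suc m)
    ≡⟨ cong ((N C k) *_) (packings-last (N ∸ k) k m) ⟩
  (N C k) * (packings (N ∸ k) k m * ((N ∸ k ∸ m * k) C k))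
    ≡⟨ *-assoc (N C k) (packings (N ∸ k) k m) _ ⟨
  packings N k (suc m) * ((N ∸ k ∸ m * k) C k)
    ≡⟨ cong (λ r → packings N k (suc m) * (r C k)) (∸-+-assoc N k (m * k)) ⟩
  packings N k (suc m) * ((N ∸ suc m * k) C k) ∎
  where open ≡-Reasoning

prodBinom≡packings : ∀ n k m → prodBinom n k m ≡ packings (n ∸ k) k m
prodBinom≡packings n k zero    = refl
prodBinom≡packings n k (suc m) = begin
  prodBinom n k m * ((n ∸ suc m * k) C k)
    ≡⟨ cong₂ (λ x r → x * (r C k)) (prodBinom≡packings n k m) (sym (∸-+-assoc n k (m * k))) ⟩
  packings (n ∸ k) k m * ((n ∸ k ∸ m * k) C k)
    ≡⟨ packings-last (n ∸ k) k m ⟨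
  packings (n ∸ k) k (suc m) ∎
  where open ≡-Reasoning

packings-positive : ∀ {N k} m → m * k ≤ N → 0 < packings N k m
packings-positive zero _ = z<s
packings-positive {N} {k} (suc m) k+mk≤N = *-mono-≤
  (k≤n⇒0<nCk (m+n≤o⇒m≤o k k+mk≤N))
  (packings-positive m (m+n≤o⇒n≤o∸m k k+mk≤N))

prodBinom-positive : ∀ {n k} m → suc m * k ≤ n → 0 < prodBinom n k m
prodBinom-positive {n} {k} m k+mk≤n =
  subst (0 <_) (sym (prodBinom≡packings n k m)) (packings-positive m (m+n≤o⇒n≤o∸m k k+mk≤n))

-- Finite lists

module _ {a} {A : Set a} where

  unique-⊆⇒length≤ : {xs ys : List A} → Unique xs → xs ⊆ ys → length xs ≤ length ys
  unique-⊆⇒length≤ {[]}     _              _     = z≤n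
  unique-⊆⇒length≤ {x ∷ xs} (x∉xs ∷ xs!) xs⊆ys with ∈-∃++ (xs⊆ys (here refl))
  ... | us , vs , refl =
    ≤-trans (s≤s (unique-⊆⇒length≤ xs! xs⊆us++vs)) (≤-reflexive (sym (length-++-sucʳ us x vs)))
    where
    xs⊆us++vs : xs ⊆ us ++ vs
    xs⊆us++vs y∈xs with ∈-++⁻ us (xs⊆ys (there y∈xs))
    ... | inj₁ y∈us         = ∈-++⁺ˡ y∈us
    ... | inj₂ (here refl)  = contradiction refl (All.lookup x∉xs y∈xs)
    ... | inj₂ (there y∈vs) = ∈-++⁺ʳ us y∈vs

  unique-⊆-length≥⇒⊇ : DecidableEquality A → {xs ys : List A} →
    Unique xs → xs ⊆ ys → length ys ≤ length xs → ys ⊆ xs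
  unique-⊆-length≥⇒⊇ _≟_ {xs} xs! xs⊆ys ∣ys∣≤∣xs∣ {y} y∈ys with DecMembership._∈?_ _≟_ y xs
  ... | yes y∈xs = y∈xs
  ... | no  y∉xs = contradiction ∣ys∣≤∣xs∣
    (<⇒≱ (unique-⊆⇒length≤ (All.¬Any⇒All¬ xs y∉xs ∷ xs!) λ where
      (here refl)  → y∈ys
      (there z∈xs) → xs⊆ys z∈xs))

  allPairs-lookup : ∀ {r} {R : Rel A r} → Symmetric R → ∀ {x y xs} →
    AllPairs R xs → x ∈ xs → y ∈ xs → x ≢ y → R x y
  allPairs-lookup R-sym (_   ∷ _)     (here refl)  (here refl)  x≢x = contradiction refl x≢x
  allPairs-lookup R-sym (xRs ∷ _)     (here refl)  (there y∈xs) _   = All.lookup xRs y∈xs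
  allPairs-lookup R-sym (yRs ∷ _)     (there x∈xs) (here refl)  _   = R-sym (All.lookup yRs x∈xs)
  allPairs-lookup R-sym (_   ∷ pairs) (there x∈xs) (there y∈xs) x≢y = allPairs-lookup R-sym pairs x∈xs y∈xs x≢y

  length*≤sum-map : ∀ {f : A → ℕ} {m xs} → All (λ x → m ≤ f x) xs → length xs * m ≤ sum (map f xs)
  length*≤sum-map []           = z≤n
  length*≤sum-map (m≤fx ∷ m≤f) = +-mono-≤ m≤fx (length*≤sum-map m≤f)

  *sum-map≤length* : ∀ c (f : A → ℕ) {d xs} →
    All (λ x → c * f x ≤ d) xs → c * sum (map f xs) ≤ length xs * d
  *sum-map≤length* c f [] = ≤-reflexive (*-zeroʳ c)
  *sum-map≤length* c f {d} {x ∷ xs} (cfx≤d ∷ cf≤d) = begin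
    c * (f x + sum (map f xs))      ≡⟨ *-distribˡ-+ c (f x) _ ⟩
    c * f x + c * sum (map f xs)    ≤⟨ +-mono-≤ cfx≤d (*sum-map≤length* c f cf≤d) ⟩
    d + length xs * d               ∎
    where open ≤-Reasoning

module _ {a b r} {A : Set a} {B : Set b} {R : A → B → Set r} (R? : ∀ x y → Dec (R x y)) where

  rowDegree : List B → A → ℕ
  rowDegree ys x = length (filter (R? x) ys)

  columnDegree : List A → B → ℕ
  columnDegree xs y = length (filter (λ x → R? x y) xs)

  sum-columnDegree-∷ : ∀ x xs ys →
    sum (map (columnDegree (x ∷ xs)) ys) ≡ rowDegree ys x + sum (map (columnDegree xs) ys)
  sum-columnDegree-∷ x xs []       = refl
  sum-columnDegree-∷ x xs (y ∷ ys) with does (R? x y) | sum-columnDegree-∷ x xs ys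
  ... | false | ih =
    trans (cong (columnDegree xs y +_) ih) (x∙yz≈y∙xz (columnDegree xs y) (rowDegree ys x) _)
  ... | true  | ih =
    cong suc (trans (cong (columnDegree xs y +_) ih) (x∙yz≈y∙xz (columnDegree xs y) (rowDegree ys x) _))

  sum-rowDegree≡sum-columnDegree : ∀ xs ys → sum (map (rowDegree ys) xs) ≡ sum (map (columnDegree xs) ys)
  sum-rowDegree≡sum-columnDegree []       ys = sym (sum-zero ys)
    where
    sum-zero : ∀ ys → sum (map (columnDegree []) ys) ≡ 0
    sum-zero []       = refl
    sum-zero (_ ∷ ys) = sum-zero ys
  sum-rowDegree≡sum-columnDegree (x ∷ xs) ys =
    trans (cong (rowDegree ys x +_) (sum-rowDegree≡sum-columnDegree xs ys)) (sym (sum-columnDegree-∷ x xs ys))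

  double-count : ∀ c {m d xs ys} →
    All (λ x → m ≤ rowDegree ys x) xs → All (λ y → c * columnDegree xs y ≤ d) ys →
    c * (length xs * m) ≤ length ys * d
  double-count c {m} {d} {xs} {ys} m≤row c*column≤d = begin
    c * (length xs * m)                  ≤⟨ *-monoʳ-≤ c (length*≤sum-map m≤row) ⟩
    c * sum (map (rowDegree ys) xs)      ≡⟨ cong (c *_) (sum-rowDegree≡sum-columnDegree xs ys) ⟩
    c * sum (map (columnDegree xs) ys)   ≤⟨ *sum-map≤length* c (columnDegree xs) c*column≤d ⟩
    length ys * d                        ∎
    where open ≤-Reasoning

-- Subsets of [n]

private variable
  n k : ℕ
  p q : Subset n

_≟ₛ_ : DecidableEquality (Subset n)
_≟ₛ_ = Vec.≡-dec Bool._≟_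

_∈?_ : (p : Subset n) (ps : List (Subset n)) → Dec (p ∈ ps)
_∈?_ = DecMembership._∈?_ _≟ₛ_

0<∣p∣⇒Nonempty : 0 < ∣ p ∣ → Nonempty p
0<∣p∣⇒Nonempty {n} {p} 0<∣p∣ with nonempty? p
... | yes nonempty = nonempty
... | no  empty    = contradiction (trans (cong ∣_∣ (Empty-unique empty)) (∣⊥∣≡0 n)) (n>0⇒n≢0 0<∣p∣)

∣p∣≡0⇒p≡⊥ : ∣ p ∣ ≡ 0 → p ≡ ⊥
∣p∣≡0⇒p≡⊥ ∣p∣≡0 = Empty-unique λ (_ , x∈p) → m<n⇒n≢0 (x∈p⇒∣p-x∣<∣p∣ x∈p) ∣p∣≡0

x∈⋃⁺ : ∀ {x} {ps : List (Subset n)} → Any (x ∈ₛ_) ps → x ∈ₛ ⋃ ps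
x∈⋃⁺ (here x∈p)   = x∈p∪q⁺ (inj₁ x∈p)
x∈⋃⁺ (there x∈ps) = x∈p∪q⁺ (inj₂ (x∈⋃⁺ x∈ps))

x∈⋃⁻ : ∀ {x} (ps : List (Subset n)) → x ∈ₛ ⋃ ps → Any (x ∈ₛ_) ps
x∈⋃⁻ []       x∈⊥ = contradiction x∈⊥ ∉⊥
x∈⋃⁻ (p ∷ ps) x∈∪ with x∈p∪q⁻ p (⋃ ps) x∈∪
... | inj₁ x∈p = here x∈p
... | inj₂ x∈⋃ = there (x∈⋃⁻ ps x∈⋃)

Disjoint-sym : Symmetric (Disjoint {n})
Disjoint-sym {x = p} {q} p#q (x , x∈q∩p) =
  let x∈q , x∈p = x∈p∩q⁻ q p x∈q∩p in p#q (x , x∈p∩q⁺ (x∈p , x∈q))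

Disjoint⇒≢ : Nonempty p → Disjoint p q → p ≢ q
Disjoint⇒≢ (x , x∈p) p#p refl = p#p (x , x∈p∩q⁺ (x∈p , x∈p))

Disjoint⇒⊆∁ : Disjoint p q → p ⊆ₛ ∁ q
Disjoint⇒⊆∁ p#q x∈p = x∉p⇒x∈∁p λ x∈q → p#q (_ , x∈p∩q⁺ (x∈p , x∈q))

⊆∁⇒Disjoint : p ⊆ₛ ∁ q → Disjoint p q
⊆∁⇒Disjoint {p = p} {q} p⊆∁q (x , x∈p∩q) =
  let x∈p , x∈q = x∈p∩q⁻ p q x∈p∩q in x∈∁p⇒x∉p (p⊆∁q x∈p) x∈q

Disjoint-⋃⁺ : {qs : List (Subset n)} → All (Disjoint p) qs → Disjoint p (⋃ qs)
Disjoint-⋃⁺ {p = p} {qs} p#qs (x , x∈p∩⋃) with x∈p∩q⁻ p (⋃ qs) x∈p∩⋃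
... | x∈p , x∈⋃ with find (x∈⋃⁻ qs x∈⋃)
...   | q , q∈qs , x∈q = All.lookup p#qs q∈qs (x , x∈p∩q⁺ (x∈p , x∈q))

Disjoint-⋃⁻ : {qs : List (Subset n)} → Disjoint p (⋃ qs) → All (Disjoint p) qs
Disjoint-⋃⁻ {p = p} p#⋃ = All.tabulate λ {q} q∈qs (x , x∈p∩q) →
  let x∈p , x∈q = x∈p∩q⁻ p q x∈p∩q in p#⋃ (x , x∈p∩q⁺ (x∈p , x∈⋃⁺ (lose q∈qs x∈q)))

∣p∪q∣≡∣p∣+∣q∣ : (p q : Subset n) → Disjoint p q → ∣ p ∪ q ∣ ≡ ∣ p ∣ + ∣ q ∣
∣p∪q∣≡∣p∣+∣q∣ []            []            _   = refl
∣p∪q∣≡∣p∣+∣q∣ (inside  ∷ p) (inside  ∷ q) p#q = contradiction (_ , here) p#q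
∣p∪q∣≡∣p∣+∣q∣ (inside  ∷ p) (outside ∷ q) p#q = cong suc (∣p∪q∣≡∣p∣+∣q∣ p q (drop-∷-Empty p#q))
∣p∪q∣≡∣p∣+∣q∣ (outside ∷ p) (inside  ∷ q) p#q =
  trans (cong suc (∣p∪q∣≡∣p∣+∣q∣ p q (drop-∷-Empty p#q))) (sym (+-suc ∣ p ∣ ∣ q ∣))
∣p∪q∣≡∣p∣+∣q∣ (outside ∷ p) (outside ∷ q) p#q = ∣p∪q∣≡∣p∣+∣q∣ p q (drop-∷-Empty p#q)

∣⋃∣≡length*k : {ps : List (Subset n)} →
  AllPairs Disjoint ps → All (λ p → ∣ p ∣ ≡ k) ps → ∣ ⋃ ps ∣ ≡ length ps * k
∣⋃∣≡length*k {n} [] [] = ∣⊥∣≡0 n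
∣⋃∣≡length*k {ps = p ∷ ps} (p#ps ∷ ps#) (∣p∣≡k ∷ ∣ps∣≡k) =
  trans (∣p∪q∣≡∣p∣+∣q∣ p (⋃ ps) (Disjoint-⋃⁺ p#ps)) (cong₂ _+_ ∣p∣≡k (∣⋃∣≡length*k ps# ∣ps∣≡k))

disjoint⇒unique : {ps : List (Subset n)} → AllPairs Disjoint ps → All Nonempty ps → Unique ps
disjoint⇒unique []           []         = []
disjoint⇒unique (p#ps ∷ ps#) (ne ∷ nes) = All.map (Disjoint⇒≢ ne) p#ps ∷ disjoint⇒unique ps# nes

kSubsets : Subset n → ℕ → List (Subset n)
kSubsets p             zero    = [ ⊥ ]
kSubsets []            (suc k) = []
kSubsets (outside ∷ p) (suc k) = map (outside ∷_) (kSubsets p (suc k))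
kSubsets (inside  ∷ p) (suc k) = map (inside ∷_) (kSubsets p k) ++ map (outside ∷_) (kSubsets p (suc k))

length-kSubsets : (p : Subset n) → ∀ k → length (kSubsets p k) ≡ ∣ p ∣ C k
length-kSubsets p             zero    = refl
length-kSubsets []            (suc k) = refl
length-kSubsets (outside ∷ p) (suc k) = trans (length-map _ (kSubsets p (suc k))) (length-kSubsets p (suc k))
length-kSubsets (inside  ∷ p) (suc k) = begin
  length (map (inside ∷_) (kSubsets p k) ++ map (outside ∷_) (kSubsets p (suc k)))
    ≡⟨ length-++ (map (inside ∷_) (kSubsets p k)) ⟩
  length (map (inside ∷_) (kSubsets p k)) + length (map (outside ∷_) (kSubsets p (suc k)))
    ≡⟨ cong₂ _+_ (length-map _ (kSubsets p k)) (length-map _ (kSubsets p (suc k))) ⟩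
  length (kSubsets p k) + length (kSubsets p (suc k))
    ≡⟨ cong₂ _+_ (length-kSubsets p k) (length-kSubsets p (suc k)) ⟩
  ∣ p ∣ C k + ∣ p ∣ C suc k
    ≡⟨ nCk+nC[k+1]≡[n+1]C[k+1] ∣ p ∣ k ⟩
  suc ∣ p ∣ C suc k ∎
  where open ≡-Reasoning

∈-kSubsets⁺ : q ⊆ₛ p → ∣ q ∣ ≡ k → q ∈ kSubsets p k
∈-kSubsets⁺ {k = zero} _ ∣q∣≡0 = here (∣p∣≡0⇒p≡⊥ ∣q∣≡0)
∈-kSubsets⁺ {q = inside  ∷ q} {outside ∷ p} {suc k} q⊆p _ = contradiction (q⊆p here) λ ()
∈-kSubsets⁺ {q = outside ∷ q} {outside ∷ p} {suc k} q⊆p ∣q∣≡1+k =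
  ∈-map⁺ _ (∈-kSubsets⁺ (drop-∷-⊆ q⊆p) ∣q∣≡1+k)
∈-kSubsets⁺ {q = inside  ∷ q} {inside  ∷ p} {suc k} q⊆p ∣q∣≡1+k =
  ∈-++⁺ˡ (∈-map⁺ _ (∈-kSubsets⁺ (drop-∷-⊆ q⊆p) (suc-injective ∣q∣≡1+k)))
∈-kSubsets⁺ {q = outside ∷ q} {inside  ∷ p} {suc k} q⊆p ∣q∣≡1+k =
  ∈-++⁺ʳ (map (inside ∷_) (kSubsets p k)) (∈-map⁺ _ (∈-kSubsets⁺ (drop-∷-⊆ q⊆p) ∣q∣≡1+k))

∈-kSubsets⁻ : (p : Subset n) → ∀ k → q ∈ kSubsets p k → q ⊆ₛ p × ∣ q ∣ ≡ k
∈-kSubsets⁻ {n} p zero (here refl) = ⊥⊆ , ∣⊥∣≡0 n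
∈-kSubsets⁻ (outside ∷ p) (suc k) q∈ with ∈-map⁻ _ q∈
... | r , r∈ , refl = let r⊆p , ∣r∣≡ = ∈-kSubsets⁻ p (suc k) r∈ in out⊆ r⊆p , ∣r∣≡
∈-kSubsets⁻ (inside ∷ p) (suc k) q∈ with ∈-++⁻ (map (inside ∷_) (kSubsets p k)) q∈
... | inj₁ q∈map with ∈-map⁻ _ q∈map
...   | r , r∈ , refl = let r⊆p , ∣r∣≡ = ∈-kSubsets⁻ p k r∈ in s⊆s r⊆p , cong suc ∣r∣≡
∈-kSubsets⁻ (inside ∷ p) (suc k) q∈ | inj₂ q∈map with ∈-map⁻ _ q∈map
...   | r , r∈ , refl = let r⊆p , ∣r∣≡ = ∈-kSubsets⁻ p (suc k) r∈ in out⊆ r⊆p , ∣r∣≡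

-- Subpartitions with prescribed classes

private variable
  ℓ m   : ℕ
  A B S : Subset n
  Cs    : List (Subset n)
  F     : List (SubPartition n k ℓ)

_∋?_ : (P : SubPartition n k ℓ) (A : Subset n) → Dec (A ∈ classes P)
P ∋? A = A ∈? classes P

sameClasses? : (P Q : SubPartition n k ℓ) → Dec (SameClasses P Q)
sameClasses? P Q = classes⊆? P Q ×-dec classes⊆? Q P
  where
  classes⊆? : ∀ P Q → Dec (∀ A → A ∈ classes P → A ∈ classes Q)
  classes⊆? P Q = map′ (λ P⊆Q A → P⊆Q {A}) (λ P⊆Q {A} → P⊆Q A) (DecSubset._⊆?_ _≟ₛ_ (classes P) (classes Q))

class-size : (P : SubPartition n k ℓ) → A ∈ classes P → ∣ A ∣ ≡ k
class-size P = All.lookup (sizes P)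

classes-disjoint : (P : SubPartition n k ℓ) → A ∈ classes P → B ∈ classes P → A ≢ B → Disjoint A B
classes-disjoint P = allPairs-lookup Disjoint-sym (disj P)

classes-unique : 0 < k → (P : SubPartition n k ℓ) → Unique (classes P)
classes-unique 0<k P = disjoint⇒unique (disj P)
  (All.map (λ ∣A∣≡k → 0<∣p∣⇒Nonempty (subst (0 <_) (sym ∣A∣≡k) 0<k)) (sizes P))

Extends : List (Subset n) → SubPartition n k ℓ → Set
Extends Cs P = All (_∈ classes P) Cs

extends⇒disjoint : (P : SubPartition n k ℓ) → Unique Cs → Extends Cs P → AllPairs Disjoint Cs
extends⇒disjoint P []           []           = []
extends⇒disjoint P (A≢Cs ∷ Cs!) (A∈P ∷ Cs⊆P) =
  All.zipWith (λ (A≢B , B∈P) → classes-disjoint P A∈P B∈P A≢B) (A≢Cs , Cs⊆P) ∷ extends⇒disjoint P Cs! Cs⊆P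

extends-all⇒sameClasses : (P Q : SubPartition n k ℓ) → Unique Cs → length Cs ≡ ℓ →
  Extends Cs P → Extends Cs Q → SameClasses P Q
extends-all⇒sameClasses {ℓ = ℓ} {Cs = Cs} P Q Cs! ∣Cs∣≡ℓ Cs⊆P Cs⊆Q =
    (λ A A∈P → All.lookup Cs⊆Q (classes⊆Cs P Cs⊆P A∈P))
  , (λ A A∈Q → All.lookup Cs⊆P (classes⊆Cs Q Cs⊆Q A∈Q))
  where
  classes⊆Cs : ∀ R → Extends Cs R → classes R ⊆ Cs
  classes⊆Cs R Cs⊆R =
    unique-⊆-length≥⇒⊇ _≟ₛ_ Cs! (All.lookup Cs⊆R) (≤-reflexive (trans (len R) (sym ∣Cs∣≡ℓ)))

furtherClasses : ℕ → List (Subset n) → List (Subset n)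
furtherClasses k Cs = kSubsets (∁ (⋃ Cs)) k

length-furtherClasses : (P : SubPartition n k ℓ) → Unique Cs → Extends Cs P →
  length (furtherClasses k Cs) ≡ (n ∸ length Cs * k) C k
length-furtherClasses {n} {k} {Cs = Cs} P Cs! Cs⊆P = begin
  length (furtherClasses k Cs)    ≡⟨ length-kSubsets (∁ (⋃ Cs)) k ⟩
  ∣ ∁ (⋃ Cs) ∣ C k                ≡⟨ cong (_C k) (∣∁p∣≡n∸∣p∣ (⋃ Cs)) ⟩
  (n ∸ ∣ ⋃ Cs ∣) C k              ≡⟨ cong (λ r → (n ∸ r) C k) ∣⋃Cs∣≡length*k ⟩
  (n ∸ length Cs * k) C k         ∎
  where
  open ≡-Reasoning
  ∣⋃Cs∣≡length*k : ∣ ⋃ Cs ∣ ≡ length Cs * k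
  ∣⋃Cs∣≡length*k = ∣⋃∣≡length*k (extends⇒disjoint P Cs! Cs⊆P) (All.map (class-size P) Cs⊆P)

furtherClass-unique : 0 < k → A ∈ furtherClasses k Cs → Unique Cs → Unique (A ∷ Cs)
furtherClass-unique {k} {Cs = Cs} 0<k A∈ Cs! with ∈-kSubsets⁻ (∁ (⋃ Cs)) k A∈
... | A⊆∁⋃ , refl = All.map (Disjoint⇒≢ (0<∣p∣⇒Nonempty 0<k)) (Disjoint-⋃⁻ (⊆∁⇒Disjoint A⊆∁⋃)) ∷ Cs!

classes⊆Cs++furtherClasses : (P : SubPartition n k ℓ) → Extends Cs P →
  classes P ⊆ Cs ++ filter (P ∋?_) (furtherClasses k Cs)
classes⊆Cs++furtherClasses {Cs = Cs} P Cs⊆P {A} A∈P with A ∈? Cs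
... | yes A∈Cs = ∈-++⁺ˡ A∈Cs
... | no  A∉Cs = ∈-++⁺ʳ Cs (∈-filter⁺ (P ∋?_) (∈-kSubsets⁺ (Disjoint⇒⊆∁ A#⋃Cs) (class-size P A∈P)) A∈P)
  where
  A#⋃Cs : Disjoint A (⋃ Cs)
  A#⋃Cs = Disjoint-⋃⁺ (All.tabulate λ B∈Cs →
    classes-disjoint P A∈P (All.lookup Cs⊆P B∈Cs) λ { refl → A∉Cs B∈Cs })

m≤rowDegree-furtherClasses : 0 < k → length Cs + m ≡ ℓ → (P : SubPartition n k ℓ) → Extends Cs P →
  m ≤ rowDegree _∋?_ (furtherClasses k Cs) P
m≤rowDegree-furtherClasses {k} {Cs = Cs} {m} {ℓ} 0<k ∣Cs∣+m≡ℓ P Cs⊆P = +-cancelˡ-≤ (length Cs) _ _ (begin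
  length Cs + m
    ≡⟨ trans ∣Cs∣+m≡ℓ (sym (len P)) ⟩
  length (classes P)
    ≤⟨ unique-⊆⇒length≤ (classes-unique 0<k P) (classes⊆Cs++furtherClasses P Cs⊆P) ⟩
  length (Cs ++ filter (P ∋?_) (furtherClasses k Cs))
    ≡⟨ length-++ Cs ⟩
  length Cs + rowDegree _∋?_ (furtherClasses k Cs) P ∎)
  where open ≤-Reasoning

through : Subset n → List (SubPartition n k ℓ) → List (SubPartition n k ℓ)
through A = filter (_∋? A)

through-distinct : (A : Subset n) → Distinct F → Distinct (through A F)
through-distinct A = AllPairs.filter⁺ (_∋? A)

through-extends : (A : Subset n) (F : List (SubPartition n k ℓ)) →
  All (Extends Cs) F → All (Extends (A ∷ Cs)) (through A F)
through-extends A F Cs⊆F =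
  All.zipWith (λ (A∈P , Cs⊆P) → A∈P ∷ Cs⊆P) (All.all-filter (_∋? A) F , All.filter⁺ (_∋? A) Cs⊆F)

length-extensions-≤ : 0 < k → ∀ m → Unique Cs → length Cs + m ≡ ℓ →
  (F : List (SubPartition n k ℓ)) → Distinct F → All (Extends Cs) F →
  m ! * length F ≤ packings (n ∸ length Cs * k) k m
length-extensions-≤ _ m _ _ [] _ _ = ≤-trans (≤-reflexive (*-zeroʳ (m !))) z≤n
length-extensions-≤ _ zero _ _ (_ ∷ []) _ _ = ≤-refl
length-extensions-≤ _ zero Cs! ∣Cs∣+0≡ℓ (P ∷ Q ∷ _) ((P≠Q ∷ _) ∷ _) (Cs⊆P ∷ Cs⊆Q ∷ _) =
  contradiction (extends-all⇒sameClasses P Q Cs! (trans (sym (+-identityʳ _)) ∣Cs∣+0≡ℓ) Cs⊆P Cs⊆Q) P≠Q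
length-extensions-≤ {k} {n} {Cs} 0<k (suc m) Cs! ∣Cs∣+1+m≡ℓ F@(P₀ ∷ _) F! Cs⊆F@(Cs⊆P₀ ∷ _) = begin
  suc m * m ! * length F
    ≡⟨ rearrange (suc m) (m !) (length F) ⟩
  m ! * (length F * suc m)
    ≤⟨ double-count _∋?_ (m !) m<rowDegree (All.tabulate length-through-≤) ⟩
  length (furtherClasses k Cs) * packings (n ∸ suc (length Cs) * k) k m
    ≡⟨ cong₂ (λ x r → x * packings r k m) (length-furtherClasses P₀ Cs! Cs⊆P₀) ∸-suc-* ⟩
  packings (n ∸ length Cs * k) k (suc m) ∎
  where
  open ≤-Reasoning
  rearrange : ∀ x y z → x * y * z ≡ y * (z * x)
  rearrange = solve-∀

  m<rowDegree : All (λ P → m < rowDegree _∋?_ (furtherClasses k Cs) P) F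
  m<rowDegree = All.map (λ {P} → m≤rowDegree-furtherClasses 0<k ∣Cs∣+1+m≡ℓ P) Cs⊆F

  ∸-suc-* : n ∸ suc (length Cs) * k ≡ n ∸ length Cs * k ∸ k
  ∸-suc-* = trans (cong (n ∸_) (+-comm k (length Cs * k))) (sym (∸-+-assoc n (length Cs * k) k))

  length-through-≤ : ∀ {A} → A ∈ furtherClasses k Cs →
    m ! * length (through A F) ≤ packings (n ∸ suc (length Cs) * k) k m
  length-through-≤ {A} A∈ = length-extensions-≤ 0<k m
    (furtherClass-unique 0<k A∈ Cs!) (trans (sym (+-suc (length Cs) m)) ∣Cs∣+1+m≡ℓ)
    (through A F) (through-distinct A F!) (through-extends A F Cs⊆F)

-- Intersecting families

CommonClass : Subset n → List (SubPartition n k ℓ) → Set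
CommonClass S F = All (λ P → S ∈ classes P) F

Trivial : List (SubPartition n k ℓ) → Set
Trivial F = ∃ λ S → CommonClass S F

Nontrivial : List (SubPartition n k ℓ) → Set
Nontrivial F = ∀ A → Any (λ P → A ∉ classes P) F

trivial⊎nontrivial : (F : List (SubPartition n k ℓ)) → Trivial F ⊎ Nontrivial F
trivial⊎nontrivial F with anySubset? (λ A → All.all? (_∋? A) F)
... | yes common  = inj₁ common
... | no  ¬common = inj₂ λ A → All.¬All⇒Any¬ (_∋? A) F λ A∈F → ¬common (A , A∈F)

commonClass⇒≤prodBinom : 0 < k → (F : List (SubPartition n k (1 + m))) → Distinct F →
  CommonClass S F → m ! * length F ≤ prodBinom n k m
commonClass⇒≤prodBinom {k} {n} {m} 0<k F F! S∈F = begin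
  m ! * length F              ≤⟨ length-extensions-≤ 0<k m ([] ∷ []) refl F F! (All.map (_∷ []) S∈F) ⟩
  packings (n ∸ 1 * k) k m    ≡⟨ cong (λ r → packings (n ∸ r) k m) (*-identityˡ k) ⟩
  packings (n ∸ k) k m        ≡⟨ prodBinom≡packings n k m ⟨
  prodBinom n k m             ∎
  where open ≤-Reasoning

Canonical : Subset n → List (SubPartition n k ℓ) → Set
Canonical S F = ∀ Q → S ∈ classes Q ⇔ Any (SameClasses Q) F

-- If Q ∋ S were missing from F, the family Q ∷ F would violate commonClass⇒≤prodBinom.
commonClass-attaining⇒canonical : 0 < k → (F : List (SubPartition n k (1 + m))) → Distinct F →
  CommonClass S F → m ! * length F ≡ prodBinom n k m →
  Canonical S F
commonClass-attaining⇒canonical {m = m} {S} 0<k F F! S∈F attained Q = mk⇔ complete sound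
  where
  complete : S ∈ classes Q → Any (SameClasses Q) F
  complete S∈Q with Any.any? (sameClasses? Q) F
  ... | yes Q∈F = Q∈F
  ... | no  Q∉F = contradiction
    (commonClass⇒≤prodBinom 0<k (Q ∷ F) (All.¬Any⇒All¬ F Q∉F ∷ F!) (S∈Q ∷ S∈F))
    (<⇒≱ (subst (_< m ! * suc (length F)) attained (*-monoʳ-< (m !) {{m !≢0}} (n<1+n (length F)))))

  sound : Any (SameClasses Q) F → S ∈ classes Q
  sound Q∈F with find Q∈F
  ... | P , P∈F , _ , P⊆Q = P⊆Q S (All.lookup S∈F P∈F)

length-meeting-≤ : ∀ c {d} (Q : SubPartition n k ℓ) → All (λ P → Intersecting P Q) F →
  (∀ {A} → A ∈ classes Q → c * length (through A F) ≤ d) → c * length F ≤ ℓ * d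
length-meeting-≤ {ℓ = ℓ} {F = F} c {d} Q F∩Q through≤d = begin
  c * length F              ≡⟨ cong (c *_) (*-identityʳ (length F)) ⟨
  c * (length F * 1)        ≤⟨ double-count _∋?_ c (All.map (λ {P} → meets P) F∩Q) (All.tabulate through≤d) ⟩
  length (classes Q) * d    ≡⟨ cong (_* d) (len Q) ⟩
  ℓ * d                     ∎
  where
  open ≤-Reasoning
  meets : ∀ P → Intersecting P Q → 1 ≤ rowDegree _∋?_ (classes Q) P
  meets P (A , A∈P , A∈Q) = filter-some (P ∋?_) (lose A∈Q A∈P)

nontrivial⇒≤packings : 0 < k → (F : List (SubPartition n k (2 + m))) → Distinct F →
  IntersectingFamily F → Nontrivial F → m ! * length F ≤ (2 + m) * ((2 + m) * packings (n ∸ 2 * k) k m)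
nontrivial⇒≤packings {k} {n} {m} 0<k F F! F∩ nontrivial with find (nontrivial ⊥)
... | P₀ , P₀∈F , _ = length-meeting-≤ (m !) P₀ (all-meet {P₀} P₀∈F) λ {A} _ → through-≤ A
  where
  all-meet : ∀ {Q} → Q ∈ F → All (λ P → Intersecting P Q) F
  all-meet {Q} Q∈F = All.tabulate λ {P} P∈F → F∩ P Q P∈F Q∈F

  through-≤ : ∀ A → m ! * length (through A F) ≤ (2 + m) * packings (n ∸ 2 * k) k m
  through-≤ A with find (nontrivial A)
  ... | Q , Q∈F , A∉Q = length-meeting-≤ (m !) Q (All.filter⁺ (_∋? A) (all-meet Q∈F)) through-through-≤
    where
    through-through-≤ : ∀ {B} → B ∈ classes Q →
      m ! * length (through B (through A F)) ≤ packings (n ∸ 2 * k) k m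
    through-through-≤ {B} B∈Q = length-extensions-≤ 0<k m (((λ { refl → A∉Q B∈Q }) ∷ []) ∷ [] ∷ []) refl
      (through B (through A F)) (through-distinct B (through-distinct A F!))
      (through-extends B (through A F) (through-extends A F (All.universal (λ _ → []) F)))

nontrivial⇒3k≤n : {F : List (SubPartition n k 2)} → IntersectingFamily F → Nontrivial F → 3 * k ≤ n
nontrivial⇒3k≤n {n} {k} {F} F∩ nontrivial with find (nontrivial ⊥)
... | P₀ , P₀∈F , _ = 3k≤n P₀ P₀∈F
  where
  3k≤n : ∀ P₀ → P₀ ∈ F → 3 * k ≤ n
  3k≤n P₀@(record { classes = A ∷ B ∷ [] ; len = refl ; disj = (A#B ∷ []) ∷ _ }) P₀∈F
    with find (nontrivial A) | find (nontrivial B)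
  ... | Q , Q∈F , A∉Q | R , R∈F , B∉R with F∩ Q R Q∈F R∈F
  ... | D , D∈Q , D∈R =
    subst (_≤ n) (∣⋃∣≡length*k disjoint (class-size R A∈R ∷ class-size Q B∈Q ∷ class-size Q D∈Q ∷ []))
      (∣p∣≤n (⋃ (A ∷ B ∷ D ∷ [])))
    where
    B∈Q : B ∈ classes Q
    B∈Q with F∩ P₀ Q P₀∈F Q∈F
    ... | _ , here refl         , A∈Q = contradiction A∈Q A∉Q
    ... | _ , there (here refl) , B∈Q = B∈Q

    A∈R : A ∈ classes R
    A∈R with F∩ P₀ R P₀∈F R∈F
    ... | _ , here refl         , A∈R = A∈R
    ... | _ , there (here refl) , B∈R = contradiction B∈R B∉R

    disjoint : AllPairs Disjoint (A ∷ B ∷ D ∷ [])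
    disjoint = (A#B ∷ classes-disjoint R A∈R D∈R (λ { refl → A∉Q D∈Q }) ∷ [])
             ∷ (classes-disjoint Q B∈Q D∈Q (λ { refl → B∉R D∈R }) ∷ [])
             ∷ [] ∷ []

nontrivial⇒[1+m][2+m]²<[n∸k]Ck : ∀ m {F : List (SubPartition n k (2 + m))} → 3 ≤ k → (2 + m) * k ≤ n →
  IntersectingFamily F → Nontrivial F → (1 + m) * ((2 + m) * (2 + m)) < (n ∸ k) C k
nontrivial⇒[1+m][2+m]²<[n∸k]Ck {n} {k} zero 3≤k _ F∩ nontrivial = begin-strict
  4             <⟨ m≤m+n 5 13 ⟩
  18            <⟨ m*[1+m]²<nCk {2} ≤-refl 3≤k (m+n≤o⇒n≤o∸m k (nontrivial⇒3k≤n F∩ nontrivial)) ⟩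
  (n ∸ k) C k   ∎
  where open ≤-Reasoning
nontrivial⇒[1+m][2+m]²<[n∸k]Ck {k = k} (suc q) 3≤k ℓk≤n _ _ =
  m*[1+m]²<nCk {2 + q} (s≤s (s≤s z≤n)) 3≤k (m+n≤o⇒n≤o∸m k ℓk≤n)

nontrivial⇒<prodBinom : ∀ m → 3 ≤ k → (2 + m) * k ≤ n → (F : List (SubPartition n k (2 + m))) →
  Distinct F → IntersectingFamily F → Nontrivial F → (1 + m) ! * length F < prodBinom n k (1 + m)
nontrivial⇒<prodBinom {k} {n} m 3≤k ℓk≤n F F! F∩ nontrivial = begin-strict
  (1 + m) * m ! * length F
    ≡⟨ *-assoc (1 + m) (m !) (length F) ⟩
  (1 + m) * (m ! * length F)
    ≤⟨ *-monoʳ-≤ (1 + m) (nontrivial⇒≤packings (≤-trans z<s 3≤k) F F! F∩ nontrivial) ⟩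
  (1 + m) * ((2 + m) * ((2 + m) * packings (n ∸ 2 * k) k m))
    ≡⟨ rearrange (1 + m) (2 + m) (packings (n ∸ 2 * k) k m) ⟩
  (1 + m) * ((2 + m) * (2 + m)) * packings (n ∸ 2 * k) k m
    ≡⟨ cong (λ r → (1 + m) * ((2 + m) * (2 + m)) * packings r k m) n∸2k≡n∸k∸k ⟩
  (1 + m) * ((2 + m) * (2 + m)) * packings (n ∸ k ∸ k) k m
    <⟨ *-monoˡ-< (packings (n ∸ k ∸ k) k m) (nontrivial⇒[1+m][2+m]²<[n∸k]Ck m 3≤k ℓk≤n F∩ nontrivial) ⟩
  packings (n ∸ k) k (1 + m)
    ≡⟨ prodBinom≡packings n k (1 + m) ⟨
  prodBinom n k (1 + m) ∎
  where
  open ≤-Reasoning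
  instance _ = >-nonZero (packings-positive {n ∸ k ∸ k} {k} m (m+n≤o⇒n≤o∸m k (m+n≤o⇒n≤o∸m k ℓk≤n)))

  rearrange : ∀ x y z → x * (y * (y * z)) ≡ x * (y * y) * z
  rearrange = solve-∀

  n∸2k≡n∸k∸k : n ∸ 2 * k ≡ n ∸ k ∸ k
  n∸2k≡n∸k∸k = trans (cong (λ r → n ∸ (k + r)) (+-identityʳ k)) (sym (∸-+-assoc n k k))

commonClass⊎<prodBinom : ∀ m → 3 ≤ k → (2 + m) * k ≤ n → (F : List (SubPartition n k (2 + m))) →
  Distinct F → IntersectingFamily F →
  (∃ λ S → ∣ S ∣ ≡ k × CommonClass S F) ⊎ (1 + m) ! * length F < prodBinom n k (1 + m)
commonClass⊎<prodBinom {k} {n} m _ ℓk≤n [] _ _ =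
  inj₂ (subst (_< prodBinom n k (1 + m)) (sym (*-zeroʳ ((1 + m) !))) (prodBinom-positive (1 + m) ℓk≤n))
commonClass⊎<prodBinom m 3≤k ℓk≤n F@(P₀ ∷ _) F! F∩ with trivial⊎nontrivial F
... | inj₁ (S , S∈F@(S∈P₀ ∷ _)) = inj₁ (S , class-size P₀ S∈P₀ , S∈F)
... | inj₂ nontrivial           = inj₂ (nontrivial⇒<prodBinom m 3≤k ℓk≤n F F! F∩ nontrivial)

theorem1 : (n k ℓ : ℕ) → 1 ≤ n → 2 ≤ ℓ → 3 ≤ k → k * ℓ ≤ n →
    (F : List (SubPartition n k ℓ)) → Distinct F → IntersectingFamily F →
    ((ℓ ∸ 1) ! * length F ≤ prodBinom n k (ℓ ∸ 1))
    × ((ℓ ∸ 1) ! * length F ≡ prodBinom n k (ℓ ∸ 1) →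
       ∃ λ (S : Subset n) → ∣ S ∣ ≡ k ×
         ((Q : SubPartition n k ℓ) → (S ∈ classes Q ⇔ Any (SameClasses Q) F)))
theorem1 n k 1 _ (s≤s ())
theorem1 n k (suc (suc m)) _ _ 3≤k kℓ≤n F F! F∩
  with commonClass⊎<prodBinom m 3≤k (subst (_≤ n) (*-comm k (2 + m)) kℓ≤n) F F! F∩
... | inj₁ (S , ∣S∣≡k , S∈F) =
    commonClass⇒≤prodBinom 0<k F F! S∈F
  , λ attained → S , ∣S∣≡k , commonClass-attaining⇒canonical 0<k F F! S∈F attained
  where
  0<k : 0 < k
  0<k = ≤-trans z<s 3≤k
... | inj₂ strict = <⇒≤ strict , λ attained → contradiction attained (<⇒≢ strict)
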